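{- Let $\mathcal{H}$ be a nonempty regular $3$-uniform hypergraph. Then there is a spanning subhypergraph $\mathcal{C}\subseteq \mathcal{H}$ such that $\deg_{\mathcal{C}} v\in \{1, 2, 3\}$ for all $v\in V(\mathcal{H})$.
   Context: A hypergraph $\mathcal{H}$ consists of a finite vertex set $V(\mathcal{H})$ and a set $E(\mathcal{H})$ of subsets of $V(\mathcal{H})$, called edges. It is nonempty if it has at least one edge. It is $r$-uniform if every edge has exactly $r$ vertices. The degree $\deg_{\mathcal{H}} v$ of a vertex $v$ is the number of edges containing $v$; $\mathcal{H}$ is $d$-regular if every vertex has degree $d$, and regular if it is $d$-regular for some $d$. A spanning subhypergraph $\mathcal{C}\subseteq\mathcal{H}$ is a hypergraph with $V(\mathcal{C})=V(\mathcal{H})$ and $E(\mathcal{C})\subseteq E(\mathcal{H})$. -}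

module Defs where

open import Data.Fin.Base using (Fin)
open import Data.Fin.Subset using (Subset; ∣_∣)
open import Data.Fin.Subset.Properties using (_∈?_)
open import Data.List.Base using (List; filter; length)
open import Data.List.Membership.Propositional using (_∈_)
open import Data.List.Relation.Binary.Subset.Propositional using (_⊆_)
open import Data.List.Relation.Unary.Unique.Propositional using (Unique)
open import Data.Nat.Base using (ℕ)
open import Data.Product.Base using (∃)
open import Relation.Binary.PropositionalEquality.Core using (_≡_)

-- The vertex set is Fin n.  The set of edges is a duplicate-free list, so that
-- there are no multiple edges and list lengths count distinct edges; the order
-- of the list is irrelevant to every notion below.
record Hypergraph (n : ℕ) : Set where
  field
    edges  : List (Subset n)
    unique : Unique edges

open Hypergraph public

Nonempty : ∀ {n} → Hypergraph n → Set
Nonempty H = ∃ λ e → e ∈ edges H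

Uniform : ∀ {n} → ℕ → Hypergraph n → Set
Uniform r H = ∀ e → e ∈ edges H → ∣ e ∣ ≡ r

deg : ∀ {n} → Hypergraph n → Fin n → ℕ
deg H v = length (filter (v ∈?_) (edges H))

RegularOfDegree : ∀ {n} → ℕ → Hypergraph n → Set
RegularOfDegree d H = ∀ v → deg H v ≡ d

Regular : ∀ {n} → Hypergraph n → Set
Regular H = ∃ λ d → RegularOfDegree d H

-- Both hypergraphs have vertex set Fin n, so subhypergraphs in this sense are
-- automatically spanning.
SpanningSubhypergraph : ∀ {n} → Hypergraph n → Hypergraph n → Set
SpanningSubhypergraph C H = edges C ⊆ edges H

{-# OPTIONS --safe #-}
-- Start from the fractional weighting that gives every edge the weight 2/d, so
-- that the weights around each vertex add up to 2, and round it to {0,1} in the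
-- style of Beck and Fiala.  While some weights are fractional, call a vertex
-- alive if at least three fractional edges (with multiplicity) contain it and
-- its weights still add up to 2; any rounding of the remaining edges leaves a
-- vertex that is not alive with a degree in {1,2,3}.  If the vectors of the
-- fractional edges, restricted to the alive vertices, are linearly dependent,
-- then the weights can be moved along a dependency, without changing the sums
-- at alive vertices, until one of them becomes 0 or 1.  Otherwise there is a
-- transversal of nonzero entries, which assigns to the m fractional edges
-- distinct alive vertices on them.  Since the m edges have only 3m incidences,
-- each alive vertex is assigned to an edge and lies on exactly three fractional
-- edges, and at most one edge at it has been chosen so far.  Choosing its own
-- edge precisely when no edge has been chosen yet gives it a degree in {1,2,3}.
--
-- All weights are scaled to integers between 0 and a common D.
module Submission where

open import Defs
open import Data.Bool.Base using (Bool; true; false; if_then_else_)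
open import Data.Empty using (⊥)
open import Data.Fin.Base using (Fin; zero; suc; punchIn; punchOut)
import Data.Fin.Properties as Fin
open import Data.Fin.Subset using (Subset; ∣_∣)
open import Data.Fin.Subset.Properties using (_∈?_)
open import Data.Integer.Base as ℤ using (ℤ; +_; 0ℤ; 1ℤ; -_; +≤+; +<+)
import Data.Integer.Properties as ℤ
open import Data.Integer.Tactic.RingSolver using (solve-∀)
open import Data.List.Base using (List; []; _∷_; allFin; cartesianProduct; filter; length; lookup)
open import Data.List.Membership.Propositional using (_∈_)
open import Data.List.Membership.Propositional.Properties using (∈-allFin; ∈-cartesianProduct⁺; ∈-lookup)
open import Data.List.Relation.Binary.Subset.Propositional using (_⊆_)
open import Data.List.Relation.Binary.Subset.Propositional.Properties using (All-resp-⊇)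
open import Data.List.Relation.Unary.AllPairs using ([]; _∷_)
open import Data.List.Relation.Unary.Any using (here; there; index)
open import Data.List.Relation.Unary.Unique.Propositional using (Unique)
open import Data.Nat.Base as ℕ using (ℕ; zero; suc; z≤n; s≤s)
import Data.Nat.Properties as ℕ
open import Data.Product.Base using (Σ; ∃; ∃₂; _×_; _,_; proj₁; proj₂)
open import Data.Sum.Base using (_⊎_; inj₁; inj₂; [_,_]′)
open import Data.Vec.Base using ([]; _∷_)
open import Data.Vec.Functional using (removeAt; insertAt)
open import Data.Vec.Functional.Properties using (removeAt-punchOut; insertAt-lookup; insertAt-punchIn)
open import Function.Base using (_∘_; id)
open import Function.Definitions using (Injective)
open import Relation.Binary.PropositionalEquality
open import Relation.Nullary using (yes; no; does; contradiction)
open import Relation.Unary using (Decidable)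
import Algebra.Properties.Semiring.Sum as Sum

module ∑ℤ = Sum ℤ.+-*-semiring
module ∑ℕ = Sum ℕ.+-*-semiring

private
  variable
    m n : ℕ

-- Integer linear algebra: kernel vectors and transversals

infixl 7 _∙_
_∙_ : (Fin m → ℤ) → (Fin m → ℤ) → ℤ
f ∙ g = ∑ℤ.sum (λ e → f e ℤ.* g e)

∙-linearʳ : ∀ x y (f g h : Fin m → ℤ) →
            f ∙ (λ e → x ℤ.* g e ℤ.+ y ℤ.* h e) ≡ x ℤ.* (f ∙ g) ℤ.+ y ℤ.* (f ∙ h)
∙-linearʳ {zero} x y f g h = step x y
  where
  step : ∀ x y → 0ℤ ≡ x ℤ.* 0ℤ ℤ.+ y ℤ.* 0ℤ
  step = solve-∀
∙-linearʳ {suc m} x y f g h = trans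
  (cong (λ t → f zero ℤ.* (x ℤ.* g zero ℤ.+ y ℤ.* h zero) ℤ.+ t) (∙-linearʳ x y (f ∘ suc) (g ∘ suc) (h ∘ suc)))
  (step x y (f zero) (g zero) (h zero) ((f ∘ suc) ∙ (g ∘ suc)) ((f ∘ suc) ∙ (h ∘ suc)))
  where
  step : ∀ x y a b c p q → a ℤ.* (x ℤ.* b ℤ.+ y ℤ.* c) ℤ.+ (x ℤ.* p ℤ.+ y ℤ.* q)
                         ≡ x ℤ.* (a ℤ.* b ℤ.+ p) ℤ.+ y ℤ.* (a ℤ.* c ℤ.+ q)
  step = solve-∀

∙-zeroʳ : ∀ (f : Fin m → ℤ) → f ∙ (λ _ → 0ℤ) ≡ 0ℤ
∙-zeroʳ {m} f = trans (∑ℤ.sum-cong-≗ (λ e → ℤ.*-zeroʳ (f e))) (∑ℤ.sum-replicate-zero m)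

Matrix : ℕ → ℕ → Set
Matrix n m = Fin n → Fin m → ℤ

Kernel : Matrix n m → Set
Kernel A = ∃ λ z → (∃ λ e → z e ≢ 0ℤ) × ∀ v → A v ∙ z ≡ 0ℤ

Transversal : Matrix n m → Set
Transversal A = ∃ λ τ → Injective _≡_ _≡_ τ × ∀ e → A (τ e) e ≢ 0ℤ

clearRow : Fin n → Matrix n m → Matrix n m
clearRow r A v e with v Fin.≟ r
... | yes _ = 0ℤ
... | no  _ = A v e

clearRow-≢ : ∀ {r v : Fin n} (A : Matrix n m) → v ≢ r → ∀ e → clearRow r A v e ≡ A v e
clearRow-≢ {r = r} {v} A v≢r e with v Fin.≟ r
... | yes v≡r = contradiction v≡r v≢r
... | no  _   = refl

clearRow-≢0 : ∀ {r v : Fin n} (A : Matrix n m) {e} → clearRow r A v e ≢ 0ℤ → v ≢ r × A v e ≢ 0ℤ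
clearRow-≢0 {r = r} {v} A ≢0 with v Fin.≟ r
... | yes _   = contradiction refl ≢0
... | no  v≢r = v≢r , ≢0

-- A cleared row has no nonzero entries, so the given transversal avoids `r`, which is therefore
-- free for column 0.
extendTransversal : ∀ (A : Matrix n (suc m)) r → A r zero ≢ 0ℤ →
                    Transversal (clearRow r (λ v → A v ∘ suc)) → Transversal A
extendTransversal {n} {m} A r Ar≢0 (τ , inj , τ≢0) = τ′ , inj′ , τ′≢0
  where
  A′ = λ v → A v ∘ suc
  τ′ : Fin (suc m) → Fin n
  τ′ zero    = r
  τ′ (suc e) = τ e
  τ≢r : ∀ e → τ e ≢ r
  τ≢r e = proj₁ (clearRow-≢0 A′ (τ≢0 e))
  inj′ : Injective _≡_ _≡_ τ′
  inj′ {zero}  {zero}  _  = refl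
  inj′ {zero}  {suc e} eq = contradiction (sym eq) (τ≢r e)
  inj′ {suc e} {zero}  eq = contradiction eq (τ≢r e)
  inj′ {suc e} {suc f} eq = cong suc (inj eq)
  τ′≢0 : ∀ e → A (τ′ e) e ≢ 0ℤ
  τ′≢0 zero    = Ar≢0
  τ′≢0 (suc e) = proj₂ (clearRow-≢0 A′ (τ≢0 e))

*-≢0 : ∀ {i j} → i ≢ 0ℤ → j ≢ 0ℤ → i ℤ.* j ≢ 0ℤ
*-≢0 {i} i≢0 j≢0 ij≡0 with ℤ.i*j≡0⇒i≡0∨j≡0 i ij≡0
... | inj₁ i≡0 = i≢0 i≡0
... | inj₂ j≡0 = j≢0 j≡0

-- Rows with a zero entry in column 0 are required to vanish throughout, so that
-- a row r that still has to be treated has a nonzero entry there, and a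
-- transversal of the other columns avoiding r extends to all of A.
Elimination : Matrix n (suc m) → List (Fin n) → Set
Elimination A rs = ∃ λ z → z zero ≢ 0ℤ × ∀ v → v ∈ rs ⊎ A v zero ≡ 0ℤ → A v ∙ z ≡ 0ℤ

KernelOrTransversal : ∀ m → Set
KernelOrTransversal m = ∀ {n} (A : Matrix n m) → Kernel A ⊎ Transversal A

-- The rows are treated one at a time. If `z` does not vanish on the next row `r`, recurse on the
-- other columns with row `r` cleared. A transversal there extends by `r`. A kernel vector there,
-- padded to `y₀`, vanishes on all rows but `r`, so it can correct `z` at `r` without harm
-- elsewhere, unless it vanishes on `r` as well and is itself a kernel vector of `A`.
-- Cross-multiplication takes the place of division.
eliminate : KernelOrTransversal m → ∀ (A : Matrix n (suc m)) rs →
            (Kernel A ⊎ Transversal A) ⊎ Elimination A rs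
eliminate {m} rec A [] = inj₂ (z , (λ ()) , Az≡0)
  where
  z : Fin (suc m) → ℤ
  -- The first unit vector: it only sees column 0, so it vanishes on every row with a zero entry
  -- there.
  z zero    = 1ℤ
  z (suc _) = 0ℤ
  Az≡0 : ∀ v → v ∈ [] ⊎ A v zero ≡ 0ℤ → A v ∙ z ≡ 0ℤ
  Az≡0 v (inj₂ Av≡0) = cong₂ ℤ._+_ (cong (ℤ._* 1ℤ) Av≡0) (∙-zeroʳ (A v ∘ suc))
eliminate {m} rec A (r ∷ rs) with eliminate rec A rs
... | inj₁ done = inj₁ done
... | inj₂ (z , z₀≢0 , Az≡0) with A r ∙ z ℤ.≟ 0ℤ
...   | yes Ar∙z≡0 = inj₂ (z , z₀≢0 , λ where
          _ (inj₁ (here refl)) → Ar∙z≡0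
          v (inj₁ (there v∈))  → Az≡0 v (inj₁ v∈)
          v (inj₂ Av≡0)        → Az≡0 v (inj₂ Av≡0))
...   | no Ar∙z≢0 with rec (clearRow r (λ v → A v ∘ suc))
-- A zero entry in column 0 would force `A r ∙ z` to vanish.
...     | inj₂ τ = inj₁ (inj₂ (extendTransversal A r (λ Ar≡0 → Ar∙z≢0 (Az≡0 r (inj₂ Ar≡0))) τ))
...     | inj₁ (y , (e , ye≢0) , A′y≡0) = result
  where
  y₀ : Fin (suc m) → ℤ
  y₀ zero    = 0ℤ
  y₀ (suc f) = y f

  Ay₀≡0 : ∀ v → v ≢ r → A v ∙ y₀ ≡ 0ℤ
  Ay₀≡0 v v≢r = cong₂ ℤ._+_ (ℤ.*-zeroʳ (A v zero))
    (trans (∑ℤ.sum-cong-≗ (λ f → cong (ℤ._* y f) (sym (clearRow-≢ (λ v → A v ∘ suc) v≢r f)))) (A′y≡0 v))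

  c ρ : ℤ
  c = A r ∙ y₀
  ρ = A r ∙ z

  -- The coefficients make row `r` cancel. Since `y₀` is 0 in column 0, the entry there is `c` times
  -- that of `z`, which is nonzero unless `c` is.
  z′ : Fin (suc m) → ℤ
  z′ f = c ℤ.* z f ℤ.+ - ρ ℤ.* y₀ f

  cancel : ∀ c ρ → c ℤ.* ρ ℤ.+ - ρ ℤ.* c ≡ 0ℤ
  cancel = solve-∀

  zeros : ∀ c ρ → c ℤ.* 0ℤ ℤ.+ - ρ ℤ.* 0ℤ ≡ 0ℤ
  zeros = solve-∀

  z′₀ : ∀ c ρ z → c ℤ.* z ℤ.+ - ρ ℤ.* 0ℤ ≡ c ℤ.* z
  z′₀ = solve-∀

  at-r : A r ∙ z′ ≡ 0ℤ
  at-r = trans (∙-linearʳ c (- ρ) (A r) z y₀) (cancel c ρ)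

  elsewhere : ∀ v → v ≢ r → A v ∙ z ≡ 0ℤ → A v ∙ z′ ≡ 0ℤ
  elsewhere v v≢r Av∙z≡0 = trans (∙-linearʳ c (- ρ) (A v) z y₀)
    (trans (cong₂ (λ p q → c ℤ.* p ℤ.+ - ρ ℤ.* q) Av∙z≡0 (Ay₀≡0 v v≢r)) (zeros c ρ))

  Az′≡0 : ∀ v → v ∈ r ∷ rs ⊎ A v zero ≡ 0ℤ → A v ∙ z′ ≡ 0ℤ
  Az′≡0 v v∈ with v Fin.≟ r | v∈
  ... | yes refl | _                  = at-r
  ... | no v≢r   | inj₁ (here v≡r)    = contradiction v≡r v≢r
  ... | no v≢r   | inj₁ (there v∈rs)  = elsewhere v v≢r (Az≡0 v (inj₁ v∈rs))
  ... | no v≢r   | inj₂ Av≡0          = elsewhere v v≢r (Az≡0 v (inj₂ Av≡0))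

  result : (Kernel A ⊎ Transversal A) ⊎ Elimination A (r ∷ rs)
  result with c ℤ.≟ 0ℤ
  ... | no  c≢0 = inj₂ (z′ , (λ z′₀≡0 → *-≢0 c≢0 z₀≢0 (trans (sym (z′₀ c ρ (z zero))) z′₀≡0)) , Az′≡0)
  ... | yes c≡0 = inj₁ (inj₁ (y₀ , (suc e , ye≢0) , λ v → kernel v))
    where
    kernel : ∀ v → A v ∙ y₀ ≡ 0ℤ
    kernel v with v Fin.≟ r
    ... | yes refl = c≡0
    ... | no  v≢r  = Ay₀≡0 v v≢r

-- Induction on the number of columns: when all rows have been treated, the vector left by the
-- elimination lies in the kernel.
kernelOrTransversal : ∀ m → KernelOrTransversal m
kernelOrTransversal zero    A = inj₂ ((λ ()) , (λ { {()} }) , λ ())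
kernelOrTransversal (suc m) {n} A with eliminate (kernelOrTransversal m) A (allFin n)
... | inj₁ done             = done
... | inj₂ (z , z₀≢0 , Az≡0) = inj₁ (z , (zero , z₀≢0) , λ v → Az≡0 v (inj₁ (∈-allFin v)))

-- Moving weights along a line to the boundary of a box

0≤* : ∀ {i j} → 0ℤ ℤ.≤ i → 0ℤ ℤ.≤ j → 0ℤ ℤ.≤ i ℤ.* j
0≤* {i} {j} 0≤i 0≤j = subst (ℤ._≤ i ℤ.* j) (ℤ.*-zeroʳ i)
  (ℤ.*-monoˡ-≤-nonNeg i {{ℤ.nonNegative 0≤i}} 0≤j)

0≤*-cancelˡ : ∀ {i j} → 0ℤ ℤ.< i → 0ℤ ℤ.≤ i ℤ.* j → 0ℤ ℤ.≤ j
0≤*-cancelˡ {i} {j} 0<i 0≤ij = ℤ.*-cancelˡ-≤-pos 0ℤ j i {{ℤ.positive 0<i}}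
  (subst (ℤ._≤ i ℤ.* j) (sym (ℤ.*-zeroʳ i)) 0≤ij)

-v*u+u*v≡0 : ∀ v u → - v ℤ.* u ℤ.+ u ℤ.* v ≡ 0ℤ
-v*u+u*v≡0 = solve-∀

-- The point p/q = u i / (- v i) is where the ray u + t v first leaves the
-- nonnegative orthant.
minimalRatio : ∀ {I : Set} (u v : I → ℤ) → (∀ i → 0ℤ ℤ.< u i) → ∀ i₀ → v i₀ ℤ.< 0ℤ → ∀ xs →
               ∃ λ i → v i ℤ.< 0ℤ × ∀ j → j ∈ xs → 0ℤ ℤ.≤ - v i ℤ.* u j ℤ.+ u i ℤ.* v j
minimalRatio u v 0<u i₀ v<0 [] = i₀ , v<0 , λ _ ()
minimalRatio u v 0<u i₀ v<0 (j ∷ xs) with minimalRatio u v 0<u i₀ v<0 xs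
... | i , vi<0 , ok with 0ℤ ℤ.≤? - v i ℤ.* u j ℤ.+ u i ℤ.* v j
...   | yes 0≤ = i , vi<0 , λ where
        _ (here refl) → 0≤
        k (there k∈)  → ok k k∈
...   | no 0≰ = j , vj<0 , λ where
        _ (here refl) → ℤ.≤-reflexive (sym (-v*u+u*v≡0 (v j) (u j)))
        k (there k∈)  → later k (ok k k∈)
  where
  0<-v : ∀ {k} → v k ℤ.< 0ℤ → 0ℤ ℤ.< - v k
  0<-v = ℤ.neg-mono-<

  nonNeg : ∀ i → v i ℤ.< 0ℤ → ∀ k → 0ℤ ℤ.≤ v k → 0ℤ ℤ.≤ - v i ℤ.* u k ℤ.+ u i ℤ.* v k
  nonNeg i vi<0 k 0≤vk = ℤ.+-mono-≤ (0≤* (ℤ.<⇒≤ (0<-v vi<0)) (ℤ.<⇒≤ (0<u k)))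
                                    (0≤* (ℤ.<⇒≤ (0<u i)) 0≤vk)

  vj<0 : v j ℤ.< 0ℤ
  vj<0 = ℤ.≰⇒> (λ 0≤vj → 0≰ (nonNeg i vi<0 j 0≤vj))

  -- If `v k` is negative too, both summands on the left are nonnegative, because `i` passes at `k`
  -- but fails at `j`. Hence so is the right-hand side, and the positive factor `- v i` can be
  -- cancelled.
  exchange : ∀ vi ui vj uj vk uk →
             - vj ℤ.* (- vi ℤ.* uk ℤ.+ ui ℤ.* vk) ℤ.+ - vk ℤ.* - (- vi ℤ.* uj ℤ.+ ui ℤ.* vj)
             ≡ - vi ℤ.* (- vj ℤ.* uk ℤ.+ uj ℤ.* vk)
  exchange = solve-∀

  later : ∀ k → 0ℤ ℤ.≤ - v i ℤ.* u k ℤ.+ u i ℤ.* v k → 0ℤ ℤ.≤ - v j ℤ.* u k ℤ.+ u j ℤ.* v k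
  later k ik with 0ℤ ℤ.≤? v k
  ... | yes 0≤vk = nonNeg j vj<0 k 0≤vk
  ... | no  0≰vk = 0≤*-cancelˡ (0<-v vi<0) (subst (0ℤ ℤ.≤_) (exchange (v i) (u i) (v j) (u j) (v k) (u k))
    (ℤ.+-mono-≤ (0≤* (ℤ.<⇒≤ (0<-v vj<0)) ik)
                (0≤* (ℤ.<⇒≤ (0<-v (ℤ.≰⇒> 0≰vk))) (ℤ.neg-mono-≤ (ℤ.<⇒≤ (ℤ.≰⇒> 0≰))))))

𝟙 : Bool → ℕ
𝟙 b = if b then 1 else 0

Tight : ℤ → (Fin m → ℤ) → Set
Tight D w = ∃₂ λ e b → w e ≡ + 𝟙 b ℤ.* D

InBox : ℤ → (Fin m → ℤ) → Set
InBox D w = ∀ e → 0ℤ ℤ.≤ w e × w e ℤ.≤ D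

-- Apply `minimalRatio` to the 2m slacks `w e` and `D - w e`, which change at the rates `z e` and
-- `- z e`. A nonzero entry of `z` makes one of its two slacks decrease, and the first slack to
-- vanish gives the tight entry. Multiplying by `q` clears the denominator of the step length.
moveToBoundary : ∀ D (w z : Fin m → ℤ) → (∀ e → 0ℤ ℤ.< w e × w e ℤ.< D) → (∃ λ e → z e ≢ 0ℤ) →
                 ∃₂ λ q p → let w′ = λ e → q ℤ.* w e ℤ.+ p ℤ.* z e in
                 0ℤ ℤ.< q × InBox (q ℤ.* D) w′ × Tight (q ℤ.* D) w′
moveToBoundary {m} D w z float (e₀ , z≢0) = result
  where
  u v : Fin m × Bool → ℤ
  u (e , false) = w e
  u (e , true)  = D ℤ.- w e
  v (e , false) = z e
  v (e , true)  = - z e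

  0<u : ∀ i → 0ℤ ℤ.< u i
  0<u (e , false) = proj₁ (float e)
  0<u (e , true)  = ℤ.≤-<-trans (ℤ.≤-reflexive (sym (ℤ.+-inverseʳ (w e)))) (ℤ.+-monoˡ-< (- w e) (proj₂ (float e)))

  descending : ∃ λ i → v i ℤ.< 0ℤ
  descending with 0ℤ ℤ.≤? z e₀
  ... | no  0≰z = (e₀ , false) , ℤ.≰⇒> 0≰z
  ... | yes 0≤z = (e₀ , true) , ℤ.neg-mono-< (ℤ.≤∧≢⇒< 0≤z (z≢0 ∘ sym))

  all : List (Fin m × Bool)
  all = cartesianProduct (allFin m) (false ∷ true ∷ [])

  below : ∀ q p w z D → q ℤ.* (D ℤ.- w) ℤ.+ p ℤ.* - z ≡ q ℤ.* D ℤ.- (q ℤ.* w ℤ.+ p ℤ.* z)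
  below = solve-∀

  result : ∃₂ λ q p → let w′ = λ e → q ℤ.* w e ℤ.+ p ℤ.* z e in
           0ℤ ℤ.< q × InBox (q ℤ.* D) w′ × Tight (q ℤ.* D) w′
  result with minimalRatio u v 0<u (proj₁ descending) (proj₂ descending) all
  ... | i , vi<0 , ok = q , p , ℤ.neg-mono-< vi<0 , inBox , tight i refl refl
    where
    q p : ℤ
    q = - v i
    p = u i
    inBox : InBox (q ℤ.* D) (λ e → q ℤ.* w e ℤ.+ p ℤ.* z e)
    inBox e = ok (e , false) (∈-cartesianProduct⁺ (∈-allFin e) (here refl))
            , ℤ.0≤i-j⇒j≤i (subst (0ℤ ℤ.≤_) (below q p (w e) (z e) D)
                (ok (e , true) (∈-cartesianProduct⁺ (∈-allFin e) (there (here refl)))))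
    -- Here `i` is generalised while `q` and `p` stay fixed, so that matching on it reveals which
    -- bound has been reached.
    tight : ∀ i → q ≡ - v i → p ≡ u i → Tight (q ℤ.* D) (λ e → q ℤ.* w e ℤ.+ p ℤ.* z e)
    tight (e , false) q≡ p≡ = e , false , trans (cong₂ (λ q p → q ℤ.* w e ℤ.+ p ℤ.* z e) q≡ p≡) (-v*u+u*v≡0 (z e) (w e))
    tight (e , true)  q≡ p≡ = e , true , sym (trans (ℤ.*-identityˡ (q ℤ.* D))
      (ℤ.i-j≡0⇒i≡j (q ℤ.* D) _ (trans (sym (below q p (w e) (z e) D))
        (trans (cong₂ (λ q p → q ℤ.* u (e , true) ℤ.+ p ℤ.* - z e) q≡ p≡) (-v*u+u*v≡0 (- z e) (D ℤ.- w e))))))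

-- Sums of natural numbers

∑-mono : ∀ {f g : Fin m → ℕ} → (∀ e → f e ℕ.≤ g e) → ∑ℕ.sum f ℕ.≤ ∑ℕ.sum g
∑-mono {zero}  f≤g = z≤n
∑-mono {suc m} f≤g = ℕ.+-mono-≤ (f≤g zero) (∑-mono (f≤g ∘ suc))

∑-const : ∀ m c → ∑ℕ.sum {m} (λ _ → c) ≡ m ℕ.* c
∑-const zero    c = refl
∑-const (suc m) c = cong (c ℕ.+_) (∑-const m c)

-- Induction on the number of values: by injectivity the later ones avoid `τ zero`, so that index
-- can be removed from `g`.
∑-injective : ∀ {k} {τ : Fin k → Fin n} → Injective _≡_ _≡_ τ → ∀ (g : Fin n → ℕ) →
              ∑ℕ.sum (g ∘ τ) ℕ.≤ ∑ℕ.sum g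
∑-injective {k = zero} inj g = z≤n
∑-injective {zero} {suc k} {τ} inj g with () ← τ zero
∑-injective {suc n} {suc k} {τ} inj g = begin
  g (τ zero) ℕ.+ ∑ℕ.sum (g ∘ τ ∘ suc)
    ≡⟨ cong (g (τ zero) ℕ.+_) (∑ℕ.sum-cong-≗ (λ e → removeAt-punchOut g (τ₀≢ e))) ⟨
  g (τ zero) ℕ.+ ∑ℕ.sum (removeAt g (τ zero) ∘ τ′)
    ≤⟨ ℕ.+-monoʳ-≤ (g (τ zero)) (∑-injective {τ = τ′} inj′ (removeAt g (τ zero))) ⟩
  g (τ zero) ℕ.+ ∑ℕ.sum (removeAt g (τ zero))
    ≡⟨ ∑ℕ.sum-remove {i = τ zero} g ⟨
  ∑ℕ.sum g ∎
  where
  open ℕ.≤-Reasoning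
  τ₀≢ : ∀ e → τ zero ≢ τ (suc e)
  τ₀≢ e eq with () ← inj eq
  τ′ : Fin k → Fin n
  τ′ e = punchOut (τ₀≢ e)
  inj′ : Injective _≡_ _≡_ τ′
  inj′ {e} {f} eq = Fin.suc-injective (inj (Fin.punchOut-injective (τ₀≢ e) (τ₀≢ f) eq))

-- Conditions on a vertex during the rounding

-- k counts the chosen edges at a vertex, α its incidences with the edges whose
-- weight w is still to be rounded, and D is the weight of a chosen edge.
Exact : ℤ → (Fin m → ℤ) → ℕ → (Fin m → ℕ) → Set
Exact D w k α = + k ℤ.* D ℤ.+ (+_ ∘ α) ∙ w ≡ + 2 ℤ.* D

-- The lower bound is already met, and choosing all remaining edges would not break the upper one.
Safe : ℕ → (Fin m → ℕ) → Set
Safe k α = 1 ℕ.≤ k × k ℕ.+ ∑ℕ.sum α ℕ.≤ 3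

Good : ℕ → (Fin m → ℕ) → (Fin m → Bool) → Set
Good k α c = 1 ℕ.≤ d × d ℕ.≤ 3
  where d = k ℕ.+ ∑ℕ.sum (λ e → α e ℕ.* 𝟙 (c e))

*𝟙≤ : ∀ a b → a ℕ.* 𝟙 b ℕ.≤ a
*𝟙≤ a true  = ℕ.≤-reflexive (ℕ.*-identityʳ a)
*𝟙≤ a false = ℕ.≤-trans (ℕ.≤-reflexive (ℕ.*-zeroʳ a)) z≤n

safe⇒good : ∀ {k} {α : Fin m → ℕ} → Safe k α → ∀ c → Good k α c
safe⇒good {k = k} {α} (1≤k , ≤3) c =
  ℕ.≤-trans 1≤k (ℕ.m≤m+n k _) , ℕ.≤-trans (ℕ.+-monoʳ-≤ k (∑-mono (λ e → *𝟙≤ (α e) (c e)))) ≤3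

Alive : ℤ → (Fin m → ℤ) → ℕ → (Fin m → ℕ) → Set
Alive D w k α = Exact D w k α × k ℕ.≤ 1 × 3 ℕ.≤ ∑ℕ.sum α

∙-lower : ∀ c (α : Fin m → ℕ) w → (∀ e → c ℤ.≤ w e) → + ∑ℕ.sum α ℤ.* c ℤ.≤ (+_ ∘ α) ∙ w
∙-lower {zero}  c α w c≤w = ℤ.≤-reflexive (ℤ.*-zeroˡ c)
∙-lower {suc m} c α w c≤w = ℤ.≤-trans
  (ℤ.≤-reflexive (trans (cong (ℤ._* c) (ℤ.pos-+ (α zero) (∑ℕ.sum (α ∘ suc)))) (ℤ.*-distribʳ-+ c (+ α zero) (+ ∑ℕ.sum (α ∘ suc)))))
  (ℤ.+-mono-≤ (ℤ.*-monoˡ-≤-nonNeg (+ α zero) (c≤w zero)) (∙-lower c (α ∘ suc) (w ∘ suc) (c≤w ∘ suc)))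

∙-upper : ∀ c (α : Fin m → ℕ) w → (∀ e → w e ℤ.≤ c) → (+_ ∘ α) ∙ w ℤ.≤ + ∑ℕ.sum α ℤ.* c
∙-upper {zero}  c α w w≤c = ℤ.≤-reflexive (sym (ℤ.*-zeroˡ c))
∙-upper {suc m} c α w w≤c = ℤ.≤-trans
  (ℤ.+-mono-≤ (ℤ.*-monoˡ-≤-nonNeg (+ α zero) (w≤c zero)) (∙-upper c (α ∘ suc) (w ∘ suc) (w≤c ∘ suc)))
  (ℤ.≤-reflexive (sym (trans (cong (ℤ._* c) (ℤ.pos-+ (α zero) (∑ℕ.sum (α ∘ suc)))) (ℤ.*-distribʳ-+ c (+ α zero) (+ ∑ℕ.sum (α ∘ suc))))))

Floating : ℤ → (Fin m → ℤ) → Set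
Floating D w = ∀ e → 0ℤ ℤ.< w e × w e ℤ.< D

-- Integer weights strictly between 0 and `D` lie between 1 and `D - 1`. So if the number `S` of
-- remaining incidences is positive, then kD < 2D < (k + S)D; if it is 0, then kD = 2D.
exact-bounds : ∀ {D w k} {α : Fin m → ℕ} → 0ℤ ℤ.< D → Floating D w → Exact D w k α →
               (k ≡ 2 × ∑ℕ.sum α ≡ 0) ⊎ (k ℕ.≤ 1 × 3 ℕ.≤ k ℕ.+ ∑ℕ.sum α)
exact-bounds {m} {D} {w} {k} {α} 0<D float exact = cases (∑ℕ.sum α) refl
  where
  instance _ = ℤ.positive 0<D
  S = ∑ℕ.sum α
  X = (+_ ∘ α) ∙ w

  lower : + S ℤ.≤ X
  lower = ℤ.≤-trans (ℤ.≤-reflexive (sym (ℤ.*-identityʳ (+ S)))) (∙-lower 1ℤ α w (λ e → ℤ.i<j⇒suc[i]≤j (proj₁ (float e))))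

  upper : X ℤ.≤ + S ℤ.* (ℤ.pred D)
  upper = ∙-upper (ℤ.pred D) α w (λ e → ℤ.i<j⇒i≤pred[j] (proj₂ (float e)))

  expand : ∀ k S D → k ℤ.* D ℤ.+ S ℤ.* (ℤ.-1ℤ ℤ.+ D) ≡ (k ℤ.+ S) ℤ.* D ℤ.- S
  expand = solve-∀

  cases : ∀ s → s ≡ S → (k ≡ 2 × S ≡ 0) ⊎ (k ℕ.≤ 1 × 3 ℕ.≤ k ℕ.+ S)
  cases zero 0≡S = inj₁ (ℤ.+-injective (ℤ.*-cancelʳ-≡ (+ k) (+ 2) D {{ℤ.>-nonZero 0<D}} kD≡2D) , sym 0≡S)
    where
    X≡0 : X ≡ 0ℤ
    X≡0 = ℤ.≤-antisym (subst (λ s → X ℤ.≤ + s ℤ.* ℤ.pred D) (sym 0≡S) upper) (subst (λ s → + s ℤ.≤ X) (sym 0≡S) lower)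
    kD≡2D : + k ℤ.* D ≡ + 2 ℤ.* D
    kD≡2D = trans (sym (ℤ.+-identityʳ (+ k ℤ.* D))) (trans (cong (λ x → + k ℤ.* D ℤ.+ x) (sym X≡0)) exact)
  cases (suc s) s≡S = inj₂ (ℕ.≤-pred (ℤ.drop‿+<+ k<2) , ℤ.drop‿+<+ 2<k+S)
    where
    0<S : 0ℤ ℤ.< + S
    0<S = subst (λ s → 0ℤ ℤ.< + s) s≡S (+<+ (s≤s z≤n))
    open ℤ.≤-Reasoning
    k<2 : + k ℤ.< + 2
    k<2 = ℤ.*-cancelʳ-<-nonNeg D {{ℤ.nonNegative (ℤ.<⇒≤ 0<D)}} (begin-strict
      + k ℤ.* D          ≡⟨ ℤ.+-identityʳ _ ⟨
      + k ℤ.* D ℤ.+ 0ℤ   <⟨ ℤ.+-monoʳ-< (+ k ℤ.* D) (ℤ.<-≤-trans 0<S lower) ⟩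
      + k ℤ.* D ℤ.+ X    ≡⟨ exact ⟩
      + 2 ℤ.* D          ∎)
    2<k+S : + 2 ℤ.< + (k ℕ.+ S)
    2<k+S = ℤ.*-cancelʳ-<-nonNeg D {{ℤ.nonNegative (ℤ.<⇒≤ 0<D)}} (begin-strict
      + 2 ℤ.* D                            ≡⟨ exact ⟨
      + k ℤ.* D ℤ.+ X                      ≤⟨ ℤ.+-monoʳ-≤ (+ k ℤ.* D) upper ⟩
      + k ℤ.* D ℤ.+ + S ℤ.* ℤ.pred D       ≡⟨ expand (+ k) (+ S) D ⟩
      (+ k ℤ.+ + S) ℤ.* D ℤ.- + S          <⟨ ℤ.+-monoʳ-< ((+ k ℤ.+ + S) ℤ.* D) (ℤ.neg-mono-< 0<S) ⟩
      (+ k ℤ.+ + S) ℤ.* D ℤ.+ 0ℤ           ≡⟨ ℤ.+-identityʳ _ ⟩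
      + (k ℕ.+ S) ℤ.* D                    ∎)

-- If 1 or 2 incidences remain, the bounds above leave only `k` = 1, and then the degree cannot
-- exceed 3.
safe⊎alive : ∀ {D w k} {α : Fin m → ℕ} → 0ℤ ℤ.< D → Floating D w → Exact D w k α →
             Safe k α ⊎ Alive D w k α
safe⊎alive {k = k} {α} 0<D float exact with exact-bounds {k = k} {α} 0<D float exact
... | inj₁ (refl , S≡0) = inj₁ (s≤s z≤n , ℕ.≤-trans (ℕ.≤-reflexive (cong (2 ℕ.+_) S≡0)) (ℕ.n≤1+n 2))
... | inj₂ (k≤1 , 3≤k+S) with ∑ℕ.sum α ℕ.≤? 2
...   | no  S≰2 = inj₂ (exact , k≤1 , ℕ.≰⇒> S≰2)
...   | yes S≤2 = inj₁ (ℕ.+-cancelʳ-≤ 2 1 k (ℕ.≤-trans 3≤k+S (ℕ.+-monoʳ-≤ k S≤2)) , ℕ.+-mono-≤ k≤1 S≤2)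

-- Fixing an edge whose weight is 0 or `D`

Rounding : ℕ → Set
Rounding m = ∀ {n} D w (k : Fin n → ℕ) (a : Fin n → Fin m → ℕ) → 0ℤ ℤ.< D → InBox D w →
             (∀ e → ∑ℕ.sum (λ v → a v e) ℕ.≤ 3) → (∀ v → Safe (k v) (a v) ⊎ Exact D w (k v) (a v)) →
             ∃ λ c → ∀ v → Good (k v) (a v) c

-- The contribution of the tight edge `e` moves from the weighted sum into `k`. This preserves
-- `Exact`, and also `Safe`, since `k` grows by at most the incidences that disappear.
roundTight : Rounding m → ∀ {n} D w (k : Fin n → ℕ) (a : Fin n → Fin (suc m) → ℕ) → 0ℤ ℤ.< D → InBox D w →
             (∀ e → ∑ℕ.sum (λ v → a v e) ℕ.≤ 3) → (∀ v → Safe (k v) (a v) ⊎ Exact D w (k v) (a v)) →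
             Tight D w → ∃ λ c → ∀ v → Good (k v) (a v) c
roundTight {m} rec {n} D w k a 0<D inBox col status (e , b , we≡bD)
  with rec D (removeAt w e) (λ v → k v ℕ.+ a v e ℕ.* 𝟙 b) (λ v → removeAt (a v) e) 0<D
           (inBox ∘ punchIn e) (col ∘ punchIn e) status′
  where
  status′ : ∀ v → Safe (k v ℕ.+ a v e ℕ.* 𝟙 b) (removeAt (a v) e)
                ⊎ Exact D (removeAt w e) (k v ℕ.+ a v e ℕ.* 𝟙 b) (removeAt (a v) e)
  status′ v with status v
  ... | inj₁ (1≤k , ≤3) = inj₁ (ℕ.≤-trans 1≤k (ℕ.m≤m+n (k v) _) , (begin
    k v ℕ.+ a v e ℕ.* 𝟙 b ℕ.+ ∑ℕ.sum (removeAt (a v) e)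
      ≤⟨ ℕ.+-monoˡ-≤ _ (ℕ.+-monoʳ-≤ (k v) (*𝟙≤ (a v e) b)) ⟩
    k v ℕ.+ a v e ℕ.+ ∑ℕ.sum (removeAt (a v) e)
      ≡⟨ ℕ.+-assoc (k v) (a v e) _ ⟩
    k v ℕ.+ (a v e ℕ.+ ∑ℕ.sum (removeAt (a v) e))
      ≡⟨ cong (k v ℕ.+_) (∑ℕ.sum-remove {i = e} (a v)) ⟨
    k v ℕ.+ ∑ℕ.sum (a v)
      ≤⟨ ≤3 ⟩
    3 ∎))
    where open ℕ.≤-Reasoning
  ... | inj₂ exact = inj₂ (begin
    + (k v ℕ.+ a v e ℕ.* 𝟙 b) ℤ.* D ℤ.+ rest
      ≡⟨ cong (λ t → t ℤ.* D ℤ.+ rest) (trans (ℤ.pos-+ (k v) (a v e ℕ.* 𝟙 b))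
           (cong (λ t → + k v ℤ.+ t) (ℤ.pos-* (a v e) (𝟙 b)))) ⟩
    (+ k v ℤ.+ + a v e ℤ.* + 𝟙 b) ℤ.* D ℤ.+ rest
      ≡⟨ regroup (+ k v) (+ a v e) (+ 𝟙 b) D rest ⟩
    + k v ℤ.* D ℤ.+ (+ a v e ℤ.* (+ 𝟙 b ℤ.* D) ℤ.+ rest)
      ≡⟨ cong (λ t → + k v ℤ.* D ℤ.+ (+ a v e ℤ.* t ℤ.+ rest)) we≡bD ⟨
    + k v ℤ.* D ℤ.+ (+ a v e ℤ.* w e ℤ.+ rest)
      ≡⟨ cong (λ t → + k v ℤ.* D ℤ.+ t) (∑ℤ.sum-remove {i = e} (λ f → + a v f ℤ.* w f)) ⟨
    + k v ℤ.* D ℤ.+ (+_ ∘ a v) ∙ w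
      ≡⟨ exact ⟩
    + 2 ℤ.* D ∎)
    where
    open ≡-Reasoning
    rest = (+_ ∘ removeAt (a v) e) ∙ removeAt w e
    regroup : ∀ k a b D r → (k ℤ.+ a ℤ.* b) ℤ.* D ℤ.+ r ≡ k ℤ.* D ℤ.+ (a ℤ.* (b ℤ.* D) ℤ.+ r)
    regroup = solve-∀
... | c′ , good′ = c , λ v → subst (λ d → 1 ℕ.≤ d × d ℕ.≤ 3) (degree v) (good′ v)
  where
  c : Fin (suc m) → Bool
  c = insertAt c′ e b
  degree : ∀ v → k v ℕ.+ a v e ℕ.* 𝟙 b ℕ.+ ∑ℕ.sum (λ f → a v (punchIn e f) ℕ.* 𝟙 (c′ f))
               ≡ k v ℕ.+ ∑ℕ.sum (λ f → a v f ℕ.* 𝟙 (c f))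
  degree v = begin
    k v ℕ.+ a v e ℕ.* 𝟙 b ℕ.+ ∑ℕ.sum (λ f → a v (punchIn e f) ℕ.* 𝟙 (c′ f))
      ≡⟨ ℕ.+-assoc (k v) _ _ ⟩
    k v ℕ.+ (a v e ℕ.* 𝟙 b ℕ.+ ∑ℕ.sum (λ f → a v (punchIn e f) ℕ.* 𝟙 (c′ f)))
      ≡⟨ cong (k v ℕ.+_) (cong₂ ℕ._+_ (cong (λ x → a v e ℕ.* 𝟙 x) (insertAt-lookup c′ e b))
           (∑ℕ.sum-cong-≗ (λ f → cong (λ x → a v (punchIn e f) ℕ.* 𝟙 x) (insertAt-punchIn c′ e b f)))) ⟨
    k v ℕ.+ (a v e ℕ.* 𝟙 (c e) ℕ.+ ∑ℕ.sum (λ f → a v (punchIn e f) ℕ.* 𝟙 (c (punchIn e f))))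
      ≡⟨ cong (k v ℕ.+_) (∑ℕ.sum-remove {i = e} (λ f → a v f ℕ.* 𝟙 (c f))) ⟨
    k v ℕ.+ ∑ℕ.sum (λ f → a v f ℕ.* 𝟙 (c f)) ∎
    where open ≡-Reasoning

-- Double counting of incidences

∑-tight : ∀ {h : Fin m → ℕ} c → (∀ e → c ℕ.≤ h e) → ∑ℕ.sum h ℕ.≤ m ℕ.* c → ∀ e → h e ℕ.≤ c
-- The terms other than `h e` already account for `m * c`.
∑-tight {suc m} {h} c c≤h ∑h≤ e = ℕ.+-cancelʳ-≤ (m ℕ.* c) (h e) c (begin
  h e ℕ.+ m ℕ.* c                    ≡⟨ cong (h e ℕ.+_) (∑-const m c) ⟨
  h e ℕ.+ ∑ℕ.sum {m} (λ _ → c)       ≤⟨ ℕ.+-monoʳ-≤ (h e) (∑-mono (c≤h ∘ punchIn e)) ⟩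
  h e ℕ.+ ∑ℕ.sum (removeAt h e)      ≡⟨ ∑ℕ.sum-remove {i = e} h ⟨
  ∑ℕ.sum h                           ≤⟨ ∑h≤ ⟩
  suc m ℕ.* c                        ∎)
  where open ℕ.≤-Reasoning

-- Double counting: at most 3m incidences are shared by m distinct values of τ
-- with at least three incidences each, which leaves no room for more.
module _ (a : Fin n → Fin m → ℕ) (col : ∀ e → ∑ℕ.sum (λ v → a v e) ℕ.≤ 3) where

  private
    S : Fin n → ℕ
    S v = ∑ℕ.sum (a v)

  incidences≤ : ∑ℕ.sum S ℕ.≤ m ℕ.* 3
  incidences≤ = begin
    ∑ℕ.sum S                              ≡⟨ ∑ℕ.∑-comm a ⟩
    ∑ℕ.sum (λ e → ∑ℕ.sum (λ v → a v e))   ≤⟨ ∑-mono col ⟩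
    ∑ℕ.sum {m} (λ _ → 3)                  ≡⟨ ∑-const m 3 ⟩
    m ℕ.* 3                               ∎
    where open ℕ.≤-Reasoning

  heavyRows≤ : ∀ {k} {σ : Fin k → Fin n} → Injective _≡_ _≡_ σ → (∀ i → 3 ℕ.≤ S (σ i)) → k ℕ.≤ m
  heavyRows≤ {k} {σ} inj 3≤S = ℕ.*-cancelʳ-≤ k m 3 (begin
    k ℕ.* 3                ≡⟨ ∑-const k 3 ⟨
    ∑ℕ.sum {k} (λ _ → 3)   ≤⟨ ∑-mono 3≤S ⟩
    ∑ℕ.sum (S ∘ σ)         ≤⟨ ∑-injective inj S ⟩
    ∑ℕ.sum S               ≤⟨ incidences≤ ⟩
    m ℕ.* 3                ∎)
    where open ℕ.≤-Reasoning

  module _ {τ : Fin m → Fin n} (inj : Injective _≡_ _≡_ τ) (3≤S : ∀ e → 3 ℕ.≤ S (τ e)) where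

    heavy⇒hit : ∀ v → 3 ℕ.≤ S v → ∃ λ e → τ e ≡ v
    heavy⇒hit v 3≤Sv with Fin.any? (λ e → τ e Fin.≟ v)
    ... | yes hit = hit
    ... | no ¬hit = contradiction (heavyRows≤ σ-inj 3≤Sσ) ℕ.1+n≰n
      where
      -- Together with the values of `τ`, an unhit `v` would make m + 1 distinct heavy rows.
      σ : Fin (suc m) → Fin n
      σ zero    = v
      σ (suc e) = τ e
      σ-inj : Injective _≡_ _≡_ σ
      σ-inj {zero}  {zero}  _  = refl
      σ-inj {zero}  {suc e} eq = contradiction (e , sym eq) ¬hit
      σ-inj {suc e} {zero}  eq = contradiction (e , eq) ¬hit
      σ-inj {suc e} {suc f} eq = cong suc (inj eq)
      3≤Sσ : ∀ i → 3 ℕ.≤ S (σ i)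
      3≤Sσ zero    = 3≤Sv
      3≤Sσ (suc e) = 3≤S e

    hit⇒light : ∀ e → S (τ e) ℕ.≤ 3
    hit⇒light = ∑-tight 3 3≤S (ℕ.≤-trans (∑-injective inj S) incidences≤)

-- Rounding along a transversal

alive⇒good : ∀ {k} {α : Fin m → ℕ} {c : Fin m → Bool} → k ℕ.≤ 1 → ∑ℕ.sum α ℕ.≤ 3 →
             ∀ e → α e ≢ 0 → c e ≡ (k ℕ.≡ᵇ 0) → Good k α c
alive⇒good {zero} _ _ ()
alive⇒good {suc m} {k} {α} {c} k≤1 S≤3 e αe≢0 ce≡ =
  subst (λ d → 1 ℕ.≤ d × d ℕ.≤ 3) (cong (k ℕ.+_) (sym (∑ℕ.sum-remove {i = e} (λ f → α f ℕ.* 𝟙 (c f)))))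
    (settle k (c e) k≤1 ce≡)
  where
  rest = ∑ℕ.sum (λ f → α (punchIn e f) ℕ.* 𝟙 (c (punchIn e f)))
  1≤αe : 1 ℕ.≤ α e
  1≤αe = ℕ.n≢0⇒n>0 αe≢0
  αe+rest≤3 : α e ℕ.+ rest ℕ.≤ 3
  αe+rest≤3 = begin
    α e ℕ.+ rest                        ≤⟨ ℕ.+-monoʳ-≤ (α e) (∑-mono (λ f → *𝟙≤ (α (punchIn e f)) (c (punchIn e f)))) ⟩
    α e ℕ.+ ∑ℕ.sum (removeAt α e)       ≡⟨ ∑ℕ.sum-remove {i = e} α ⟨
    ∑ℕ.sum α                            ≤⟨ S≤3 ⟩
    3                                   ∎
    where open ℕ.≤-Reasoning
  settle : ∀ k b → k ℕ.≤ 1 → b ≡ (k ℕ.≡ᵇ 0) →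
           1 ℕ.≤ k ℕ.+ (α e ℕ.* 𝟙 b ℕ.+ rest) × k ℕ.+ (α e ℕ.* 𝟙 b ℕ.+ rest) ℕ.≤ 3
  -- No edge chosen so far: `e` is chosen and contributes at least 1.
  settle zero .true _ refl rewrite ℕ.*-identityʳ (α e) = ℕ.≤-trans 1≤αe (ℕ.m≤m+n (α e) rest) , αe+rest≤3
  -- One edge chosen already: leaving out `e` gives up at least one of at most three incidences,
  -- which makes room for it.
  settle (suc zero) .false _ refl rewrite ℕ.*-zeroʳ (α e) = s≤s z≤n , ℕ.≤-trans (ℕ.+-monoˡ-≤ rest 1≤αe) αe+rest≤3
  settle (suc (suc k)) _ (s≤s ()) _

-- A zero row puts no condition on a kernel vector and cannot be a value of a transversal, so safe
-- vertices drop out of the linear algebra while the index set stays the same.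
restrictRow : ∀ {P Q : Set} → P ⊎ Q → (Fin m → ℕ) → Fin m → ℤ
restrictRow (inj₁ _) α _ = 0ℤ
restrictRow (inj₂ _) α e = + α e

restrictRow-≢0 : ∀ {P Q : Set} (s : P ⊎ Q) (α : Fin m → ℕ) {e} → restrictRow s α e ≢ 0ℤ → Q × α e ≢ 0
restrictRow-≢0 (inj₁ _) α ≢0 = contradiction refl ≢0
restrictRow-≢0 (inj₂ q) α ≢0 = q , ≢0 ∘ cong +_

roundTransversal : ∀ D w (k : Fin n → ℕ) (a : Fin n → Fin m → ℕ) →
                   (∀ e → ∑ℕ.sum (λ v → a v e) ℕ.≤ 3) →
                   (status : ∀ v → Safe (k v) (a v) ⊎ Alive D w (k v) (a v)) →
                   Transversal (λ v → restrictRow (status v) (a v)) → ∃ λ c → ∀ v → Good (k v) (a v) c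
roundTransversal {n} {m} D w k a col status (τ , inj , τ≢0) = c , good
  where
  c : Fin m → Bool
  c e = k (τ e) ℕ.≡ᵇ 0

  hit : ∀ e → Alive D w (k (τ e)) (a (τ e)) × a (τ e) e ≢ 0
  hit e = restrictRow-≢0 (status (τ e)) (a (τ e)) (τ≢0 e)

  3≤S : ∀ e → 3 ℕ.≤ ∑ℕ.sum (a (τ e))
  3≤S e = proj₂ (proj₂ (proj₁ (hit e)))

  good : ∀ v → Good (k v) (a v) c
  good v with status v
  ... | inj₁ safe = safe⇒good {k = k v} {a v} safe c
  ... | inj₂ (_ , k≤1 , 3≤Sv) with heavy⇒hit a col inj 3≤S v 3≤Sv
  ...   | e , refl = alive⇒good {k = k v} {a v} k≤1 (hit⇒light a col inj 3≤S e) e (proj₂ (hit e)) refl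

-- Rounding along a kernel vector, and the induction

exact-shift : ∀ {D k} {α : Fin m → ℕ} {w z} q p → (+_ ∘ α) ∙ z ≡ 0ℤ → Exact D w k α →
              Exact (q ℤ.* D) (λ e → q ℤ.* w e ℤ.+ p ℤ.* z e) k α
exact-shift {D = D} {k} {α} {w} {z} q p αz≡0 exact = begin
  + k ℤ.* (q ℤ.* D) ℤ.+ (+_ ∘ α) ∙ (λ e → q ℤ.* w e ℤ.+ p ℤ.* z e)
    ≡⟨ cong (λ t → + k ℤ.* (q ℤ.* D) ℤ.+ t) (∙-linearʳ q p (+_ ∘ α) w z) ⟩
  + k ℤ.* (q ℤ.* D) ℤ.+ (q ℤ.* X ℤ.+ p ℤ.* ((+_ ∘ α) ∙ z))
    ≡⟨ cong (λ t → + k ℤ.* (q ℤ.* D) ℤ.+ (q ℤ.* X ℤ.+ p ℤ.* t)) αz≡0 ⟩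
  + k ℤ.* (q ℤ.* D) ℤ.+ (q ℤ.* X ℤ.+ p ℤ.* 0ℤ)
    ≡⟨ factor (+ k) q D X p ⟩
  q ℤ.* (+ k ℤ.* D ℤ.+ X)
    ≡⟨ cong (q ℤ.*_) exact ⟩
  q ℤ.* (+ 2 ℤ.* D)
    ≡⟨ swap q (+ 2) D ⟩
  + 2 ℤ.* (q ℤ.* D) ∎
  where
  open ≡-Reasoning
  X = (+_ ∘ α) ∙ w
  factor : ∀ k q D X p → k ℤ.* (q ℤ.* D) ℤ.+ (q ℤ.* X ℤ.+ p ℤ.* 0ℤ) ≡ q ℤ.* (k ℤ.* D ℤ.+ X)
  factor = solve-∀
  swap : ∀ q t D → q ℤ.* (t ℤ.* D) ≡ t ℤ.* (q ℤ.* D)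
  swap = solve-∀

0<* : ∀ {i j} → 0ℤ ℤ.< i → 0ℤ ℤ.< j → 0ℤ ℤ.< i ℤ.* j
0<* {i} {j} 0<i 0<j = subst (ℤ._< i ℤ.* j) (ℤ.*-zeroʳ i) (ℤ.*-monoˡ-<-pos i {{ℤ.positive 0<i}} 0<j)

tight⊎floating : ∀ D (w : Fin m → ℤ) → InBox D w → Tight D w ⊎ Floating D w
tight⊎floating D w inBox with Fin.any? (λ e → w e ℤ.≟ 0ℤ)
... | yes (e , we≡0) = inj₁ (e , false , trans we≡0 (sym (ℤ.*-zeroˡ D)))
... | no ¬0 with Fin.any? (λ e → w e ℤ.≟ D)
...   | yes (e , we≡D) = inj₁ (e , true , trans we≡D (sym (ℤ.*-identityˡ D)))
...   | no ¬D = inj₂ λ e → ℤ.≤∧≢⇒< (proj₁ (inBox e)) (λ 0≡we → ¬0 (e , sym 0≡we))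
                         , ℤ.≤∧≢⇒< (proj₂ (inBox e)) (λ we≡D → ¬D (e , we≡D))

RoundingFloating : ℕ → Set
RoundingFloating m = ∀ {n} D w (k : Fin n → ℕ) (a : Fin n → Fin m → ℕ) → 0ℤ ℤ.< D → Floating D w →
                     (∀ e → ∑ℕ.sum (λ v → a v e) ℕ.≤ 3) →
                     (∀ v → Safe (k v) (a v) ⊎ Alive D w (k v) (a v)) → ∃ λ c → ∀ v → Good (k v) (a v) c

-- The move makes some weight tight, so an edge can be removed. Of being alive only `Exact` is
-- carried over; the bounds are derived afresh at the next floating stage.
roundKernel : Rounding m → ∀ {n} D w (k : Fin n → ℕ) (a : Fin n → Fin (suc m) → ℕ) → 0ℤ ℤ.< D → Floating D w →
              (∀ e → ∑ℕ.sum (λ v → a v e) ℕ.≤ 3) → (status : ∀ v → Safe (k v) (a v) ⊎ Alive D w (k v) (a v)) →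
              Kernel (λ v → restrictRow (status v) (a v)) → ∃ λ c → ∀ v → Good (k v) (a v) c
roundKernel {m} rec D w k a 0<D float col status (z , z≢0 , Az≡0) = move (moveToBoundary D w z float z≢0)
  where
  shift : ∀ q p v (s : Safe (k v) (a v) ⊎ Alive D w (k v) (a v)) → restrictRow s (a v) ∙ z ≡ 0ℤ →
          Safe (k v) (a v) ⊎ Exact (q ℤ.* D) (λ e → q ℤ.* w e ℤ.+ p ℤ.* z e) (k v) (a v)
  shift q p v (inj₁ safe)        _    = inj₁ safe
  shift q p v (inj₂ (exact , _)) az≡0 = inj₂ (exact-shift {k = k v} {a v} {w} {z} q p az≡0 exact)

  move : (∃₂ λ q p → let w′ = λ e → q ℤ.* w e ℤ.+ p ℤ.* z e in
          0ℤ ℤ.< q × InBox (q ℤ.* D) w′ × Tight (q ℤ.* D) w′) → ∃ λ c → ∀ v → Good (k v) (a v) c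
  move (q , p , 0<q , inBox , tight) =
    roundTight rec (q ℤ.* D) _ k a (0<* 0<q 0<D) inBox col (λ v → shift q p v (status v) (Az≡0 v)) tight

roundFloating : Rounding m → RoundingFloating (suc m)
roundFloating {m} rec D w k a 0<D float col status =
  [ roundKernel rec D w k a 0<D float col status , roundTransversal D w k a col status ]′
    (kernelOrTransversal (suc m) (λ v → restrictRow (status v) (a v)))

refine : ∀ {D w k} {α : Fin m → ℕ} → 0ℤ ℤ.< D → Floating D w → Safe k α ⊎ Exact D w k α → Safe k α ⊎ Alive D w k α
refine _   _     (inj₁ safe)  = inj₁ safe
refine {w = w} {k} {α} 0<D float (inj₂ exact) = safe⊎alive {w = w} {k} {α} 0<D float exact

-- Induction on the number of edges not yet rounded. The scale `D`, the weights and the counts `k`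
-- vary, as moves rescale the weights and removed edges change the counts.
rounding : ∀ m → Rounding m
rounding zero D w k a 0<D inBox col status = (λ ()) , good
  where
  good : ∀ v → Good (k v) (a v) (λ ())
  -- An empty sum cannot reach 3, so with no edges left every vertex is safe.
  good v with refine {w = w} {k v} {a v} 0<D (λ ()) (status v)
  ... | inj₁ safe = safe⇒good {k = k v} {a v} safe (λ ())
  ... | inj₂ (_ , _ , ())
rounding (suc m) D w k a 0<D inBox col status with tight⊎floating D w inBox
... | inj₁ tight = roundTight (rounding m) D w k a 0<D inBox col status tight
... | inj₂ float = roundFloating (rounding m) D w k a 0<D float col (λ v → refine {w = w} {k v} {a v} 0<D float (status v))

-- From choices of edges to spanning subhypergraphs

select : ∀ {A : Set} (xs : List A) → (Fin (length xs) → Bool) → List A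
select []       c = []
select (x ∷ xs) c = if c zero then x ∷ select xs (c ∘ suc) else select xs (c ∘ suc)

select-⊆ : ∀ {A : Set} (xs : List A) c → select xs c ⊆ xs
select-⊆ (x ∷ xs) c y∈ with c zero | y∈
... | true  | here y≡x = here y≡x
... | true  | there y∈ = there (select-⊆ xs (c ∘ suc) y∈)
... | false | y∈       = there (select-⊆ xs (c ∘ suc) y∈)

select-unique : ∀ {A : Set} {xs : List A} → Unique xs → ∀ c → Unique (select xs c)
select-unique []                    c = []
select-unique (_∷_ {xs = xs} x∉ u) c with c zero
... | true  = All-resp-⊇ (select-⊆ xs (c ∘ suc)) x∉ ∷ select-unique u (c ∘ suc)
... | false = select-unique u (c ∘ suc)

module _ {A : Set} {P : A → Set} (P? : Decidable P) where

  length-filter≡∑ : ∀ xs → length (filter P? xs) ≡ ∑ℕ.sum (λ e → 𝟙 (does (P? (lookup xs e))))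
  length-filter≡∑ [] = refl
  length-filter≡∑ (x ∷ xs) with does (P? x)
  ... | true  = cong suc (length-filter≡∑ xs)
  ... | false = length-filter≡∑ xs

  length-filter-select : ∀ xs c → length (filter P? (select xs c)) ≡
                                  ∑ℕ.sum (λ e → 𝟙 (does (P? (lookup xs e))) ℕ.* 𝟙 (c e))
  length-filter-select [] c = refl
  length-filter-select (x ∷ xs) c with c zero
  ... | true with does (P? x)
  ...   | true  = cong suc (length-filter-select xs (c ∘ suc))
  ...   | false = length-filter-select xs (c ∘ suc)
  length-filter-select (x ∷ xs) c | false = trans (length-filter-select xs (c ∘ suc))
    (cong (ℕ._+ rest) (sym (ℕ.*-zeroʳ (𝟙 (does (P? x))))))
    where rest = ∑ℕ.sum (λ e → 𝟙 (does (P? (lookup xs e))) ℕ.* 𝟙 (c (suc e)))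

∑-∈? : ∀ (p : Subset n) → ∑ℕ.sum (λ v → 𝟙 (does (v ∈? p))) ≡ ∣ p ∣
∑-∈? []          = refl
∑-∈? (true ∷ p)  = cong suc (∑-∈? p)
∑-∈? (false ∷ p) = ∑-∈? p

∙-const : ∀ c (α : Fin m → ℕ) → (+_ ∘ α) ∙ (λ _ → c) ≡ + ∑ℕ.sum α ℤ.* c
∙-const c α = ℤ.≤-antisym (∙-upper c α _ (λ _ → ℤ.≤-refl)) (∙-lower c α _ (λ _ → ℤ.≤-refl))

≤∑ : ∀ (f : Fin m → ℕ) e → f e ℕ.≤ ∑ℕ.sum f
≤∑ f zero    = ℕ.m≤m+n (f zero) _
≤∑ f (suc e) = ℕ.≤-trans (≤∑ (f ∘ suc) e) (ℕ.m≤n+m _ (f zero))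

1≤d≤3 : ∀ {d} → 1 ℕ.≤ d × d ℕ.≤ 3 → d ≡ 1 ⊎ d ≡ 2 ⊎ d ≡ 3
1≤d≤3 {1} _ = inj₁ refl
1≤d≤3 {2} _ = inj₂ (inj₁ refl)
1≤d≤3 {3} _ = inj₂ (inj₂ refl)
1≤d≤3 {suc (suc (suc (suc _)))} (_ , s≤s (s≤s (s≤s ())))

module _ (H : Hypergraph n) where

  incidence : Fin n → Fin (length (edges H)) → ℕ
  incidence v e = 𝟙 (does (v ∈? lookup (edges H) e))

  deg≡∑ : ∀ v → deg H v ≡ ∑ℕ.sum (incidence v)
  deg≡∑ v = length-filter≡∑ (v ∈?_) (edges H)

  ∑-incidence : Uniform 3 H → ∀ e → ∑ℕ.sum (λ v → incidence v e) ≡ 3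
  ∑-incidence uniform e = trans (∑-∈? (lookup (edges H) e)) (uniform _ (∈-lookup e))

  chosen : (Fin (length (edges H)) → Bool) → Hypergraph n
  chosen c = record { edges = select (edges H) c ; unique = select-unique (unique H) c }

  -- A single edge already brings three incidences, whereas degrees 0 add up to none.
  regularOfDegree0⇒⊥ : Nonempty H → RegularOfDegree 0 H → Uniform 3 H → ⊥
  regularOfDegree0⇒⊥ (_ , e∈) regular uniform = ℕ.1+n≰n {2} (ℕ.≤-trans (begin
    3                                     ≡⟨ ∑-incidence uniform e ⟨
    ∑ℕ.sum (λ v → incidence v e)          ≤⟨ ∑-mono (λ v → ≤∑ (incidence v) e) ⟩
    ∑ℕ.sum (λ v → ∑ℕ.sum (incidence v))   ≡⟨ ∑ℕ.sum-cong-≗ (λ v → trans (sym (deg≡∑ v)) (regular v)) ⟩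
    ∑ℕ.sum {n} (λ _ → 0)                  ≡⟨ ∑ℕ.sum-replicate-zero n ⟩
    0                                     ∎) z≤n)
    where
    open ℕ.≤-Reasoning
    e = index e∈

  roundRegular : ∀ d → 2 ℕ.≤ d → RegularOfDegree d H → Uniform 3 H →
                 ∃ λ c → ∀ v → Good 0 (incidence v) c
  -- The initial weight 2/d on the scale `D` = d; it is at most 1 because 2 ≤ d.
  roundRegular d 2≤d regular uniform = rounding _ (+ d) (λ _ → + 2) (λ _ → 0) incidence
    (+<+ (ℕ.≤-trans (s≤s z≤n) 2≤d)) (λ _ → +≤+ z≤n , +≤+ 2≤d)
    (λ e → ℕ.≤-reflexive (∑-incidence uniform e)) (λ v → inj₂ (exact v))
    where
    open ≡-Reasoning
    exact : ∀ v → Exact (+ d) (λ _ → + 2) 0 (incidence v)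
    exact v = begin
      + 0 ℤ.* + d ℤ.+ (+_ ∘ incidence v) ∙ (λ _ → + 2)   ≡⟨ cong (ℤ._+ (+_ ∘ incidence v) ∙ (λ _ → + 2)) (ℤ.*-zeroˡ (+ d)) ⟩
      0ℤ ℤ.+ (+_ ∘ incidence v) ∙ (λ _ → + 2)            ≡⟨ ℤ.+-identityˡ _ ⟩
      (+_ ∘ incidence v) ∙ (λ _ → + 2)                   ≡⟨ ∙-const (+ 2) (incidence v) ⟩
      + ∑ℕ.sum (incidence v) ℤ.* + 2                     ≡⟨ cong (λ t → + t ℤ.* + 2) (trans (sym (deg≡∑ v)) (regular v)) ⟩
      + d ℤ.* + 2                                        ≡⟨ ℤ.*-comm (+ d) (+ 2) ⟩
      + 2 ℤ.* + d                                        ∎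

  good⇒deg : ∀ {c v} → Good 0 (incidence v) c →
             deg (chosen c) v ≡ 1 ⊎ deg (chosen c) v ≡ 2 ⊎ deg (chosen c) v ≡ 3
  good⇒deg {c} {v} good = 1≤d≤3 (subst (λ d → 1 ℕ.≤ d × d ℕ.≤ 3)
    (sym (length-filter-select (v ∈?_) (edges H) c)) good)

theorem1p1 : ∀ (n : ℕ) (H : Hypergraph n) → Nonempty H → Regular H → Uniform 3 H →
    Σ (Hypergraph n) λ C → SpanningSubhypergraph C H ×
    (∀ (v : Fin n) → deg C v ≡ 1 ⊎ deg C v ≡ 2 ⊎ deg C v ≡ 3)
theorem1p1 n H nonempty (0 , regular) uniform = contradiction uniform (regularOfDegree0⇒⊥ H nonempty regular)
-- Here 2/d would exceed 1, but `H` itself has all degrees 1.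
theorem1p1 n H nonempty (1 , regular) uniform = H , id , inj₁ ∘ regular
theorem1p1 n H nonempty (suc (suc d) , regular) uniform =
  let c , good = roundRegular H (2 ℕ.+ d) (s≤s (s≤s z≤n)) regular uniform
  in chosen H c , select-⊆ (edges H) c , λ v → good⇒deg H {c} {v} (good v)
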